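{- Let $b\geq 2$, $e\geq 1$, $h\geq 1$, $u\geq 1$ be integers. Let $\delta$ be a positive integer, and let $$d=\frac{g(e)+1}{1-\left(\frac{b-2}{b-1}\right)^{e}}+\delta.$$ If $\sigma_{h,e,b}(u)$ has at least $d$ base $b$ digits, then the base $b$ expansion of $\sigma_{h,e,b}(u)$ is of the form $$\sigma_{h,e,b}(u)=\sum_{i=0}^{n-1}a_{i}b^{i}$$ with $a_{0}=a_1=\dots=a_{\delta}=b-1$; that is, the rightmost $\delta+1$ base $b$ digits of $\sigma_{h,e,b}(u)$ are all equal to $b-1$.
   Context: For integers $b\ge 2$ and $e\ge 1$, $S_{e,b}$ is the function on positive integers sending $x=\sum_{i=0}^{n-1}a_i b^i$ (with digits $0\le a_i\le b-1$) to $S_{e,b}(x)=\sum_{i=0}^{n-1}a_i^e$. $S_{e,b}^{h}$ denotes the $h$-fold iterate, with $S_{e,b}^0(x)=x$. For a positive integer $u$ (the attractor), a positive integer $x$ is a height $h$, $u$ attracted number if $h$ is the smallest nonnegative integer with $S_{e,b}^h(x)=u$. $\sigma_{h,e,b}(u)$ denotes the smallest height $h$, $u$ attracted number, i.e. the smallest positive integer $k$ with $S_{e,b}^h(k)=u$ and $S_{e,b}^m(k)\neq u$ for all $0\le m<h$. $g(e)$ denotes the smallest integer such that every nonnegative integer can be written as $x_1^e+x_2^e+\dots+x_{g(e)}^e$ with $x_1,\dots,x_{g(e)}$ nonnegative integers (Waring's problem). In the expansion, $n$ is the number of base $b$ digits and $0\le a_i\le b-1$. -}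

module Defs where

open import Algebra.Definitions.RawSemiring using () renaming (_^_ to power)
open import Data.Digit using (Expansion; fromDigits; toDigits)
open import Data.Fin.Base using (toℕ)
import Data.Integer.Base as ℤ
import Data.Integer.Properties as ℤ
open import Data.List.Base using (last; map)
open import Data.Maybe.Base using (just)
open import Data.Nat.Base as ℕ
  using (ℕ; zero; suc; 2+; NonTrivial; nonTrivial⇒n>1; _∸_; _^_; _≤_; _<_)
open import Data.Nat.GeneralisedArithmetic using (iterate)
open import Data.Nat.ListAction using (sum)
import Data.Nat.Properties as ℕ
open import Data.Product.Base using (∃; _×_; proj₁)
open import Data.Rational.Base as ℚ using (ℚ; 0ℚ; 1ℚ)
import Data.Rational.Properties as ℚ
import Data.Rational.Unnormalised.Base as ℚᵘ
import Data.Rational.Unnormalised.Properties as ℚᵘ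
open import Data.Vec.Base as Vec using (Vec)
open import Level using (Level)
open import Relation.Binary.PropositionalEquality
  using (_≡_; _≢_; subst; subst₂; sym)
open import Relation.Nullary.Decidable using (fromWitness)

private
  variable
    ℓ : Level

IsLeast : (ℕ → Set ℓ) → ℕ → Set ℓ
IsLeast P m = P m × (∀ n → P n → m ≤ n)

-- Least significant digit first and no leading zeros, so that `length ds` is
-- the number of base b digits of x; such a ds is unique.
IsExpansion : (b x : ℕ) → Expansion b → Set
IsExpansion b x ds = fromDigits ds ≡ x × last (map toℕ ds) ≢ just 0

-- Intended for e ≥ 1, where leading zeros would not affect the sum.
S : (e b : ℕ) .{{_ : NonTrivial b}} → ℕ → ℕ
S e b x = sum (map (λ a → toℕ a ^ e) ds)
  where ds = proj₁ (toDigits b {fromWitness (nonTrivial⇒n>1 b)} x)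

-- "h is the height of x with respect to the attractor u."
IsHeight : (e b : ℕ) .{{_ : NonTrivial b}} → (u x h : ℕ) → Set
IsHeight e b u x = IsLeast (λ h → iterate (S e b) x h ≡ u)

-- "k = σ_{h,e,b}(u)", as a relation because σ may be undefined.
Isσ : (h e b : ℕ) .{{_ : NonTrivial b}} → (u k : ℕ) → Set
Isσ h e b u = IsLeast (λ x → 0 < x × IsHeight e b u x h)

-- "s = g(e)", as a relation because that g(e) exists at all is the
-- Hilbert–Waring theorem.
IsWaring : (e s : ℕ) → Set
IsWaring e =
  IsLeast (λ s → ∀ n → ∃ λ (xs : Vec ℕ s) → Vec.sum (Vec.map (_^ e) xs) ≡ n)

infixr 8 _^ℚ_
_^ℚ_ : ℚ → ℕ → ℚ
_^ℚ_ = power ℚ.+-*-rawSemiring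

fromℕ : ℕ → ℚ
fromℕ n = ℤ.+ n ℚ./ 1

-- (b - 2) / (b - 1)
ratio : (b : ℕ) .{{_ : NonTrivial b}} → ℚ
ratio b@(2+ _) = ℤ.+ (b ∸ 2) ℚ./ (b ∸ 1)

private
  0≤ratio : ∀ b .{{_ : NonTrivial b}} → ℚ.NonNegative (ratio b)
  0≤ratio (2+ k) = ℚ.normalize-nonNeg k (suc k)

  ratio<1 : ∀ b .{{_ : NonTrivial b}} → ratio b ℚ.< 1ℚ
  ratio<1 (2+ k) = ℚ.toℚᵘ-cancel-< (ℚᵘ.<-respˡ-≃
    (ℚᵘ.≃-sym (ℚ.toℚᵘ-fromℚᵘ (ℚᵘ.mkℚᵘ (ℤ.+ k) k)))
    (ℚᵘ.*<* (subst₂ ℤ._<_ (sym (ℤ.*-identityʳ (ℤ.+ k)))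
                          (sym (ℤ.*-identityˡ (ℤ.+ suc k)))
                          (ℤ.+<+ (ℕ.n<1+n k)))))

  ratio^n≤1 : ∀ b .{{_ : NonTrivial b}} n → ratio b ^ℚ n ℚ.≤ 1ℚ
  ratio^n≤1 b zero    = ℚ.≤-refl
  ratio^n≤1 b (suc n) = ℚ.≤-trans
    (ℚ.*-monoˡ-≤-nonNeg (ratio b) {{0≤ratio b}} (ratio^n≤1 b n))
    (subst (ℚ._≤ 1ℚ) (sym (ℚ.*-identityʳ (ratio b))) (ℚ.<⇒≤ (ratio<1 b)))

  ratio^e<1 : ∀ b .{{_ : NonTrivial b}} e .{{_ : ℕ.NonZero e}} →
              ratio b ^ℚ e ℚ.< 1ℚ
  ratio^e<1 b (suc n) = ℚ.≤-<-trans
    (ℚ.*-monoˡ-≤-nonNeg (ratio b) {{0≤ratio b}} (ratio^n≤1 b n))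
    (subst (ℚ._< 1ℚ) (sym (ℚ.*-identityʳ (ratio b))) (ratio<1 b))

1-ratio^e≢0 : ∀ b .{{_ : NonTrivial b}} e .{{_ : ℕ.NonZero e}} →
              ℚ.NonZero (1ℚ ℚ.- ratio b ^ℚ e)
1-ratio^e≢0 b e = ℚ.>-nonZero
  (subst (ℚ._< 1ℚ ℚ.- r) (ℚ.+-inverseʳ r)
    (ℚ.+-monoˡ-< (ℚ.- r) (ratio^e<1 b e)))
  where r = ratio b ^ℚ e

-- (g + 1) / (1 - ((b - 2) / (b - 1))ᵉ) + δ
threshold : (b e g δ : ℕ) .{{_ : NonTrivial b}} .{{_ : ℕ.NonZero e}} → ℚ
threshold b e g δ =
  (fromℕ (g ℕ.+ 1) ℚ.÷ (1ℚ ℚ.- ratio b ^ℚ e)) {{1-ratio^e≢0 b e}}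
    ℚ.+ fromℕ δ

{-# OPTIONS --safe #-}
module Submission where

-- Let c = b − 1 and let k = σ(u) have n digits. If x < k has S x = S k, then x
-- must be u itself, so u is periodic; if u ≥ bᵍ then, because g ≥ 2ᵉ − 1, S
-- maps [0, u] below u, which is absurd. So u < bᵍ, and u b, which has height h
-- as well, forces k ≤ u b < bᵍ⁺¹, contradicting n ≥ g + 2. Hence k is the least
-- number whose digits have e-th powers summing to N = S k. Exchanging
-- neighbouring digits shows that no digit exceeds the one to its right, so if
-- the conclusion fails then all but at most δ digits are less than c, and the
-- bound on n gives N + (g + 1) cᵉ ≤ n cᵉ. But N is attained by ⌊N / cᵉ⌋ digits
-- c and g further digits that represent the remainder: fewer than n digits in
-- all.

open import Defs
open import Data.Digit using (Expansion; fromDigits; toDigits)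
open import Data.Fin.Base as Fin using (Fin; toℕ; fromℕ<)
import Data.Fin.Properties as Fin
import Data.Integer.Base as ℤ
import Data.Integer.Properties as ℤ
open import Data.List.Base using ([]; _∷_; _++_; length; map; replicate; take; last)
import Data.List.Properties as List
open import Data.List.Relation.Unary.All as All using (All; []; _∷_)
open import Data.List.Relation.Unary.Linked as Linked using (Linked; []; [-]; _∷_)
open import Data.List.Relation.Unary.Linked.Properties using (Linked⇒All)
open import Data.Maybe.Base using (just)
open import Data.Nat.Base
open import Data.Nat.DivMod using (_/_; _%_; m%n<n; m<n⇒m%n≡m; [m+kn]%n≡m%n; m≡m%n+[m/n]*n; m/n*n≤m)
open import Data.Nat.GeneralisedArithmetic using (iterate)
open import Data.Nat.ListAction using (sum)
open import Data.Nat.ListAction.Properties using (sum-++)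
open import Data.Nat.Properties
open import Data.Nat.Tactic.RingSolver using (solve-∀)
open import Data.Product.Base using (∃; _×_; _,_; proj₁)
open import Data.Rational.Base as ℚ using (0ℚ; 1ℚ; toℚᵘ)
import Data.Rational.Properties as ℚ
open import Data.Rational.Solver
open import Data.Rational.Unnormalised.Base as ℚᵘ using (mkℚᵘ; *≡*; *≤*)
import Data.Rational.Unnormalised.Properties as ℚᵘ
open import Data.Sum.Base using (_⊎_; inj₁; inj₂)
open import Data.Vec.Base as Vec using (Vec; []; _∷_)
open import Function.Base using (_∘_)
open import Relation.Binary.PropositionalEquality
open import Relation.Nullary.Decidable using (yes; no; fromWitness)
open import Relation.Nullary.Negation using (¬_; contradiction)
open +-*-Solver using (_:=_; _:+_; _:*_; _:-_; con) renaming (solve to solveℚ)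

-- Clearing denominators in the threshold.

-- `fromℕ` normalises its fraction and so does not reduce on a variable; identities are checked on
-- unnormalised fractions, and this is the passage there.
toℚᵘ-fromℕ : ∀ n → toℚᵘ (fromℕ n) ℚᵘ.≃ mkℚᵘ (ℤ.+ n) 0
toℚᵘ-fromℕ n = ℚ.toℚᵘ-fromℚᵘ (mkℚᵘ (ℤ.+ n) 0)

fromℕ-homo-+ : ∀ m n → fromℕ (m + n) ≡ fromℕ m ℚ.+ fromℕ n
fromℕ-homo-+ m n = ℚ.toℚᵘ-injective (begin-equality
  toℚᵘ (fromℕ (m + n))                  ≃⟨ toℚᵘ-fromℕ (m + n) ⟩
  mkℚᵘ (ℤ.+ (m + n)) 0
    ≡⟨ cong₂ (λ x y → mkℚᵘ (x ℤ.+ y) 0) (ℤ.*-identityʳ (ℤ.+ m)) (ℤ.*-identityʳ (ℤ.+ n)) ⟨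
  mkℚᵘ (ℤ.+ m) 0 ℚᵘ.+ mkℚᵘ (ℤ.+ n) 0      ≃⟨ ℚᵘ.+-cong (toℚᵘ-fromℕ m) (toℚᵘ-fromℕ n) ⟨
  toℚᵘ (fromℕ m) ℚᵘ.+ toℚᵘ (fromℕ n)      ≃⟨ ℚ.toℚᵘ-homo-+ (fromℕ m) (fromℕ n) ⟨
  toℚᵘ (fromℕ m ℚ.+ fromℕ n)              ∎)
  where open ℚᵘ.≤-Reasoning

fromℕ-homo-* : ∀ m n → fromℕ (m * n) ≡ fromℕ m ℚ.* fromℕ n
fromℕ-homo-* m n = ℚ.toℚᵘ-injective (begin-equality
  toℚᵘ (fromℕ (m * n))                  ≃⟨ toℚᵘ-fromℕ (m * n) ⟩
  mkℚᵘ (ℤ.+ (m * n)) 0                  ≡⟨ cong (λ x → mkℚᵘ x 0) (ℤ.pos-* m n) ⟩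
  mkℚᵘ (ℤ.+ m) 0 ℚᵘ.* mkℚᵘ (ℤ.+ n) 0      ≃⟨ ℚᵘ.*-cong (toℚᵘ-fromℕ m) (toℚᵘ-fromℕ n) ⟨
  toℚᵘ (fromℕ m) ℚᵘ.* toℚᵘ (fromℕ n)      ≃⟨ ℚ.toℚᵘ-homo-* (fromℕ m) (fromℕ n) ⟨
  toℚᵘ (fromℕ m ℚ.* fromℕ n)              ∎)
  where open ℚᵘ.≤-Reasoning

fromℕ-mono-≤ : ∀ {m n} → m ≤ n → fromℕ m ℚ.≤ fromℕ n
fromℕ-mono-≤ {m} {n} m≤n = ℚ.toℚᵘ-cancel-≤ (begin
  toℚᵘ (fromℕ m)  ≃⟨ toℚᵘ-fromℕ m ⟩
  mkℚᵘ (ℤ.+ m) 0  ≤⟨ *≤* (ℤ.*-monoʳ-≤-nonNeg ℤ.1ℤ (ℤ.+≤+ m≤n)) ⟩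
  mkℚᵘ (ℤ.+ n) 0  ≃⟨ toℚᵘ-fromℕ n ⟨
  toℚᵘ (fromℕ n)  ∎)
  where open ℚᵘ.≤-Reasoning

fromℕ-cancel-≤ : ∀ {m n} → fromℕ m ℚ.≤ fromℕ n → m ≤ n
fromℕ-cancel-≤ {m} {n} p = ℤ.drop‿+≤+ (ℤ.*-cancelʳ-≤-pos (ℤ.+ m) (ℤ.+ n) ℤ.1ℤ
  (ℚᵘ.drop-*≤* (begin
    mkℚᵘ (ℤ.+ m) 0  ≃⟨ toℚᵘ-fromℕ m ⟨
    toℚᵘ (fromℕ m)  ≤⟨ ℚ.toℚᵘ-mono-≤ p ⟩
    toℚᵘ (fromℕ n)  ≃⟨ toℚᵘ-fromℕ n ⟩
    mkℚᵘ (ℤ.+ n) 0  ∎)))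
  where open ℚᵘ.≤-Reasoning

ratio-* : ∀ a → ratio (2+ a) ℚ.* fromℕ (suc a) ≡ fromℕ a
ratio-* a = ℚ.toℚᵘ-injective (begin-equality
  toℚᵘ (ratio (2+ a) ℚ.* fromℕ (suc a))
    ≃⟨ ℚ.toℚᵘ-homo-* (ratio (2+ a)) (fromℕ (suc a)) ⟩
  toℚᵘ (ratio (2+ a)) ℚᵘ.* toℚᵘ (fromℕ (suc a))
    ≃⟨ ℚᵘ.*-cong (ℚ.toℚᵘ-fromℚᵘ (mkℚᵘ (ℤ.+ a) a)) (toℚᵘ-fromℕ (suc a)) ⟩
  mkℚᵘ (ℤ.+ a) a ℚᵘ.* mkℚᵘ (ℤ.+ suc a) 0
    ≃⟨ *≡* (ℤ.*-assoc (ℤ.+ a) (ℤ.+ suc a) ℤ.1ℤ) ⟩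
  mkℚᵘ (ℤ.+ a) 0
    ≃⟨ toℚᵘ-fromℕ a ⟨
  toℚᵘ (fromℕ a) ∎)
  where open ℚᵘ.≤-Reasoning

ratio^-* : ∀ a e → ratio (2+ a) ^ℚ e ℚ.* fromℕ (suc a ^ e) ≡ fromℕ (a ^ e)
ratio^-* a zero    = ℚ.*-identityˡ (fromℕ 1)
ratio^-* a (suc e) = begin
  (r ℚ.* r^e) ℚ.* fromℕ (suc a * suc a ^ e)
    ≡⟨ cong ((r ℚ.* r^e) ℚ.*_) (fromℕ-homo-* (suc a) (suc a ^ e)) ⟩
  (r ℚ.* r^e) ℚ.* (fromℕ (suc a) ℚ.* fromℕ (suc a ^ e))
    ≡⟨ solveℚ 4 (λ w x y z → (w :* x) :* (y :* z) := (w :* y) :* (x :* z)) refl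
         r r^e (fromℕ (suc a)) (fromℕ (suc a ^ e)) ⟩
  (r ℚ.* fromℕ (suc a)) ℚ.* (r^e ℚ.* fromℕ (suc a ^ e))
    ≡⟨ cong₂ ℚ._*_ (ratio-* a) (ratio^-* a e) ⟩
  fromℕ a ℚ.* fromℕ (a ^ e)
    ≡⟨ fromℕ-homo-* a (a ^ e) ⟨
  fromℕ (a * a ^ e) ∎
  where
  open ≡-Reasoning
  r   = ratio (2+ a)
  r^e = r ^ℚ e

-- The threshold inequality multiplied by (b − 1)ᵉ − (b − 2)ᵉ, with both sides
-- moved so that no subtraction occurs.
threshold⇒≤ : ∀ a e g δ n .{{_ : NonZero e}} → threshold (2+ a) e g δ ℚ.≤ fromℕ n →
  (g + 1 + δ) * suc a ^ e + n * a ^ e ≤ n * suc a ^ e + δ * a ^ e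
threshold⇒≤ a e g δ n thr≤n = fromℕ-cancel-≤ (begin
  fromℕ ((g + 1 + δ) * A + n * B)
    ≡⟨ trans (fromℕ-homo-+ ((g + 1 + δ) * A) (n * B))
        (cong₂ ℚ._+_ (trans (fromℕ-homo-* (g + 1 + δ) A)
                            (cong (ℚ._* A′) (fromℕ-homo-+ (g + 1) δ)))
                     (fromℕ-homo-* n B)) ⟩
  (G ℚ.+ Δ) ℚ.* A′ ℚ.+ N ℚ.* B′
    ≡⟨ cong (λ z → (z ℚ.+ Δ) ℚ.* A′ ℚ.+ N ℚ.* B′)
         (trans (cong (G ℚ.*_) (ℚ.*-inverseˡ D)) (ℚ.*-identityʳ G)) ⟨
  (G ℚ.* (1/D ℚ.* D) ℚ.+ Δ) ℚ.* A′ ℚ.+ N ℚ.* B′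
    ≡⟨ cong (λ z → (G ℚ.* (1/D ℚ.* D) ℚ.+ Δ) ℚ.* A′ ℚ.+ N ℚ.* z) (ratio^-* a e) ⟨
  (G ℚ.* (1/D ℚ.* D) ℚ.+ Δ) ℚ.* A′ ℚ.+ N ℚ.* (r ℚ.* A′)
    ≡⟨ solveℚ 6 (λ G I R X A N →
         (G :* (I :* (con 1ℚ :- R)) :+ X) :* A :+ N :* (R :* A) :=
         (G :* I :+ X) :* ((con 1ℚ :- R) :* A) :+ (N :+ X) :* (R :* A)) refl
         G 1/D r Δ A′ N ⟩
  thr ℚ.* (D ℚ.* A′) ℚ.+ (N ℚ.+ Δ) ℚ.* (r ℚ.* A′)
    ≤⟨ ℚ.+-monoˡ-≤ ((N ℚ.+ Δ) ℚ.* (r ℚ.* A′))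
         (ℚ.*-monoʳ-≤-nonNeg (D ℚ.* A′) {{ℚ.nonNegative 0≤DA}} thr≤n) ⟩
  N ℚ.* (D ℚ.* A′) ℚ.+ (N ℚ.+ Δ) ℚ.* (r ℚ.* A′)
    ≡⟨ solveℚ 4 (λ N R A X →
         N :* ((con 1ℚ :- R) :* A) :+ (N :+ X) :* (R :* A) :=
         N :* A :+ X :* (R :* A)) refl N r A′ Δ ⟩
  N ℚ.* A′ ℚ.+ Δ ℚ.* (r ℚ.* A′)
    ≡⟨ cong (λ z → N ℚ.* A′ ℚ.+ Δ ℚ.* z) (ratio^-* a e) ⟩
  N ℚ.* A′ ℚ.+ Δ ℚ.* B′
    ≡⟨ trans (fromℕ-homo-+ (n * A) (δ * B))
        (cong₂ ℚ._+_ (fromℕ-homo-* n A) (fromℕ-homo-* δ B)) ⟨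
  fromℕ (n * A + δ * B) ∎)
  where
  open ℚ.≤-Reasoning
  A = suc a ^ e
  B = a ^ e
  A′ = fromℕ A
  B′ = fromℕ B
  G = fromℕ (g + 1)
  Δ = fromℕ δ
  N = fromℕ n
  r = ratio (2+ a) ^ℚ e
  D = 1ℚ ℚ.- r
  instance
    D≢0 : ℚ.NonZero D
    D≢0 = 1-ratio^e≢0 (2+ a) e
  1/D = ℚ.1/ D
  thr = G ℚ.* 1/D ℚ.+ Δ
  -- `D ℚ.* A′` equals `A′ ℚ.- B′`, the factor by which the hypothesis is multiplied; its sign
  -- preserves the inequality.
  0≤DA : 0ℚ ℚ.≤ D ℚ.* A′
  0≤DA = begin
    0ℚ                        ≡⟨ ℚ.+-inverseʳ B′ ⟨
    B′ ℚ.- B′                 ≤⟨ ℚ.+-monoˡ-≤ (ℚ.- B′) (fromℕ-mono-≤ (^-monoˡ-≤ e (n≤1+n a))) ⟩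
    A′ ℚ.- B′                 ≡⟨ cong (λ z → A′ ℚ.- z) (ratio^-* a e) ⟨
    A′ ℚ.- r ℚ.* A′           ≡⟨ solveℚ 2 (λ A R → A :- R :* A := (con 1ℚ :- R) :* A) refl A′ r ⟩
    D ℚ.* A′                  ∎

-- Digit strings and their power sums.

private
  variable
    b : ℕ

powerSum : ℕ → Expansion b → ℕ
powerSum e ds = sum (map (λ d → toℕ d ^ e) ds)

digit-unique : (c d : Fin b) (m n : ℕ) → toℕ c + m * b ≡ toℕ d + n * b → c ≡ d × m ≡ n
digit-unique {b@(suc _)} c d m n eq = Fin.toℕ-injective c≡d , m≡n
  where
  c≡d : toℕ c ≡ toℕ d
  c≡d = begin
    toℕ c                ≡⟨ m<n⇒m%n≡m (Fin.toℕ<n c) ⟨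
    toℕ c % b            ≡⟨ [m+kn]%n≡m%n (toℕ c) m b ⟨
    (toℕ c + m * b) % b  ≡⟨ cong (_% b) eq ⟩
    (toℕ d + n * b) % b  ≡⟨ [m+kn]%n≡m%n (toℕ d) n b ⟩
    toℕ d % b            ≡⟨ m<n⇒m%n≡m (Fin.toℕ<n d) ⟩
    toℕ d                ∎
    where open ≡-Reasoning
  m≡n : m ≡ n
  m≡n = *-cancelʳ-≡ m n b (+-cancelˡ-≡ (toℕ c) (m * b) (n * b)
          (trans eq (cong (_+ n * b) (sym c≡d))))

powerSum-zero : ∀ e .{{_ : NonZero e}} (ds : Expansion b) → fromDigits ds ≡ 0 → powerSum e ds ≡ 0
powerSum-zero e       []       _  = refl
powerSum-zero {b@(suc _)} e@(suc _) (d ∷ ds) eq = cong₂ _+_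
  (cong (_^ e) (m+n≡0⇒m≡0 (toℕ d) eq))
  (powerSum-zero e ds (m*n≡0⇒m≡0 (fromDigits ds) b (m+n≡0⇒n≡0 (toℕ d) eq)))

-- Two strings with the same value differ only in leading zeros, which contribute nothing as `e` is
-- nonzero. Hence any expansion may replace the one that `S` computes with.
powerSum-cong : ∀ e .{{_ : NonZero e}} (ds es : Expansion b) →
               fromDigits ds ≡ fromDigits es → powerSum e ds ≡ powerSum e es
powerSum-cong e []       es       eq = sym (powerSum-zero e es (sym eq))
powerSum-cong e (d ∷ ds) []       eq = powerSum-zero e (d ∷ ds) eq
powerSum-cong e (d ∷ ds) (c ∷ es) eq =
  let d≡c , eq′ = digit-unique d c (fromDigits ds) (fromDigits es) eq
  in cong₂ _+_ (cong (λ x → toℕ x ^ e) d≡c) (powerSum-cong e ds es eq′)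

powerSum≡0⇒fromDigits≡0 : ∀ e (ds : Expansion b) → powerSum e ds ≡ 0 → fromDigits ds ≡ 0
powerSum≡0⇒fromDigits≡0 e []       _  = refl
powerSum≡0⇒fromDigits≡0 {b} e (d ∷ ds) eq = cong₂ (λ x y → x + y * b)
  (m^n≡0⇒m≡0 (toℕ d) e (m+n≡0⇒m≡0 (toℕ d ^ e) eq))
  (powerSum≡0⇒fromDigits≡0 e ds (m+n≡0⇒n≡0 (toℕ d ^ e) eq))

powerSum-++ : ∀ e (ds es : Expansion b) → powerSum e (ds ++ es) ≡ powerSum e ds + powerSum e es
powerSum-++ e ds es = trans (cong sum (List.map-++ _ ds es)) (sum-++ (map _ ds) (map _ es))

powerSum-≤ : ∀ e m (ds : Expansion b) → All (λ d → toℕ d ≤ m) ds → powerSum e ds ≤ length ds * m ^ e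
powerSum-≤ e m []       []          = z≤n
powerSum-≤ e m (d ∷ ds) (d≤m ∷ all) = +-mono-≤ (^-monoˡ-≤ e d≤m) (powerSum-≤ e m ds all)

digits≤ : (ds : Expansion (suc b)) → All (λ d → toℕ d ≤ b) ds
digits≤ = All.universal Fin.toℕ≤pred[n]

fromDigits-< : (ds : Expansion b) → fromDigits ds < b ^ length ds
fromDigits-< []       = ≤-refl
fromDigits-< {b} (d ∷ ds) = begin-strict
  toℕ d + fromDigits ds * b  <⟨ +-monoˡ-< (fromDigits ds * b) (Fin.toℕ<n d) ⟩
  suc (fromDigits ds) * b    ≤⟨ *-monoˡ-≤ b (fromDigits-< ds) ⟩
  b ^ length ds * b          ≡⟨ *-comm (b ^ length ds) b ⟩
  b * b ^ length ds          ∎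
  where open ≤-Reasoning

^≤fromDigits : ∀ (ds : Expansion b) {m} → last (map toℕ ds) ≢ just 0 →
               length ds ≡ suc m → b ^ m ≤ fromDigits ds
^≤fromDigits (d ∷ []) last≢0 refl = ≤-trans (n≢0⇒n>0 (last≢0 ∘ cong just)) (m≤m+n (toℕ d) _)
^≤fromDigits {b} (d ∷ d′ ∷ ds) last≢0 refl = begin
  b * b ^ length ds                  ≡⟨ *-comm b (b ^ length ds) ⟩
  b ^ length ds * b                  ≤⟨ *-monoˡ-≤ b (^≤fromDigits (d′ ∷ ds) last≢0 refl) ⟩
  fromDigits (d′ ∷ ds) * b           ≤⟨ m≤n+m _ (toℕ d) ⟩
  toℕ d + fromDigits (d′ ∷ ds) * b   ∎
  where open ≤-Reasoning

-- The bound counts by `n` and not by `length ds`, since `ds` may carry leading zeros.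
powerSum-<^ : ∀ e .{{_ : NonZero e}} n (ds : Expansion (suc b)) →
              fromDigits ds < suc b ^ n → powerSum e ds ≤ n * b ^ e
powerSum-<^ e zero    ds lt = ≤-reflexive (powerSum-zero e ds (n<1⇒n≡0 lt))
powerSum-<^ e (suc n) [] lt = z≤n
powerSum-<^ {b} e (suc n) (d ∷ ds) lt = +-mono-≤ (^-monoˡ-≤ e (Fin.toℕ≤pred[n] d))
  (powerSum-<^ e n ds (*-cancelʳ-< (suc b) (fromDigits ds) (suc b ^ n) (begin-strict
    fromDigits ds * suc b          ≤⟨ m≤n+m _ (toℕ d) ⟩
    toℕ d + fromDigits ds * suc b  <⟨ lt ⟩
    suc b * suc b ^ n              ≡⟨ *-comm (suc b) (suc b ^ n) ⟩
    suc b ^ n * suc b              ∎)))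
  where open ≤-Reasoning

powerSum₁≤fromDigits : (ds : Expansion b) → powerSum 1 ds ≤ fromDigits ds
powerSum₁≤fromDigits []       = z≤n
powerSum₁≤fromDigits {suc _} (d ∷ ds) = +-mono-≤ (≤-reflexive (*-identityʳ (toℕ d)))
  (≤-trans (powerSum₁≤fromDigits ds) (m≤m*n (fromDigits ds) _))

-- If the tail has value zero, the sum is a single digit, below `b`. Otherwise the sum replaces the
-- tail's contribution `suc m * b` by at most `suc m`, a strict loss.
powerSum₁-< : ∀ (ds : Expansion b) {u} → 1 < b → b ≤ u → fromDigits ds ≤ u → powerSum 1 ds < u
powerSum₁-< []       1<b b≤u _ = <-≤-trans (<-trans z<s 1<b) b≤u
powerSum₁-< {b} (d ∷ ds) {u} 1<b b≤u x≤u with fromDigits ds in eq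
... | zero = begin-strict
  toℕ d ^ 1 + powerSum 1 ds  ≡⟨ cong₂ _+_ (*-identityʳ (toℕ d)) (powerSum-zero 1 ds eq) ⟩
  toℕ d + 0                  ≡⟨ +-identityʳ (toℕ d) ⟩
  toℕ d                      <⟨ Fin.toℕ<n d ⟩
  b                          ≤⟨ b≤u ⟩
  u                          ∎
  where open ≤-Reasoning
... | suc m = begin-strict
  toℕ d ^ 1 + powerSum 1 ds  ≤⟨ +-mono-≤ (≤-reflexive (*-identityʳ (toℕ d))) (powerSum₁≤fromDigits ds) ⟩
  toℕ d + fromDigits ds      ≡⟨ cong (toℕ d +_) eq ⟩
  toℕ d + suc m              <⟨ +-monoʳ-< (toℕ d) (m<m*n (suc m) b 1<b) ⟩
  toℕ d + suc m * b          ≤⟨ x≤u ⟩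
  u                          ∎
  where open ≤-Reasoning

digits : ∀ b .{{_ : NonTrivial b}} x → ∃ λ (ds : Expansion b) → fromDigits ds ≡ x
digits b x = toDigits b {fromWitness (nonTrivial⇒n>1 b)} x

S-fromDigits : ∀ e .{{_ : NonZero e}} .{{_ : NonTrivial b}} (ds : Expansion b) →
               S e b (fromDigits ds) ≡ powerSum e ds
S-fromDigits {b} e ds = let es , eq = digits b (fromDigits ds) in powerSum-cong e es ds eq

-- Powers against linear factors.

-- The left side consists of the two leading binomial terms; as the exponent is at least 2, the
-- constant term 1 is left over and makes the inequality strict.
bernoulli : ∀ c e .{{_ : NonZero c}} → c ^ (2 + e) + (2 + e) * c ^ (1 + e) < suc c ^ (2 + e)
bernoulli c zero = ≤-reflexive (lem c)
  where
  lem : ∀ c → suc (c * (c * 1) + 2 * (c * 1)) ≡ suc c * (suc c * 1)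
  lem = solve-∀
bernoulli c (suc e) = begin-strict
  c ^ (3 + e) + (3 + e) * c ^ (2 + e)
    ≤⟨ m≤m+n _ ((2 + e) * c ^ (1 + e)) ⟩
  c ^ (3 + e) + (3 + e) * c ^ (2 + e) + (2 + e) * c ^ (1 + e)
    ≡⟨ lem c e (c ^ (1 + e)) ⟩
  suc c * (c ^ (2 + e) + (2 + e) * c ^ (1 + e))
    <⟨ *-monoʳ-< (suc c) (bernoulli c e) ⟩
  suc c ^ (3 + e) ∎
  where
  open ≤-Reasoning
  lem : ∀ c e p → c * (c * p) + (3 + e) * (c * p) + (2 + e) * p ≡ suc c * (c * p + (2 + e) * p)
  lem = solve-∀

-- In base `suc c`, with exponent `2 + e`, the left side bounds the power sum of `4 + e + j` digits,
-- and the right side is the least number of that length. Raising `j` by one at most doubles the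
-- left side and at least doubles the right.
*^<^ : ∀ c e j .{{_ : NonZero c}} → (4 + e + j) * c ^ (2 + e) < suc c ^ (3 + e + j)
*^<^ c e zero = begin-strict
  (4 + e + 0) * c ^ (2 + e)            ≡⟨ lem e (c ^ (2 + e)) ⟩
  c ^ (2 + e) + (3 + e) * c ^ (2 + e)  ≤⟨ +-monoˡ-≤ _ (m≤n*m (c ^ (2 + e)) c) ⟩
  c ^ (3 + e) + (3 + e) * c ^ (2 + e)  <⟨ bernoulli c (suc e) ⟩
  suc c ^ (3 + e)                      ≡⟨ cong (suc c ^_) (+-identityʳ (3 + e)) ⟨
  suc c ^ (3 + e + 0)                  ∎
  where
  open ≤-Reasoning
  lem : ∀ e p → (4 + e + 0) * p ≡ p + (3 + e) * p
  lem = solve-∀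
*^<^ c@(suc _) e (suc j) = begin-strict
  (4 + e + suc j) * p                    ≤⟨ m≤m+n _ ((3 + e + j) * p) ⟩
  (4 + e + suc j) * p + (3 + e + j) * p  ≡⟨ lem e j p ⟩
  2 * ((4 + e + j) * p)                  <⟨ *-monoʳ-< 2 (*^<^ c e j) ⟩
  2 * suc c ^ (3 + e + j)                ≤⟨ *-monoˡ-≤ (suc c ^ (3 + e + j)) (nonTrivial⇒n>1 (suc c)) ⟩
  suc c ^ (4 + e + j)                    ≡⟨ cong (suc c ^_) (+-suc (3 + e) j) ⟨
  suc c ^ (3 + e + suc j)                ∎
  where
  open ≤-Reasoning
  p = c ^ (2 + e)
  lem : ∀ e j p → (4 + e + suc j) * p + (3 + e + j) * p ≡ 2 * ((4 + e + j) * p)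
  lem = solve-∀

4+n≤2^[2+n] : ∀ n → 4 + n ≤ 2 ^ (2 + n)
4+n≤2^[2+n] zero    = ≤-refl
4+n≤2^[2+n] (suc n) = begin
  5 + n              ≤⟨ m≤m+n (5 + n) (3 + n) ⟩
  5 + n + (3 + n)    ≡⟨ lem n ⟩
  2 * (4 + n)        ≤⟨ *-monoʳ-≤ 2 (4+n≤2^[2+n] n) ⟩
  2 ^ (3 + n)        ∎
  where
  open ≤-Reasoning
  lem : ∀ n → 5 + n + (3 + n) ≡ 2 * (4 + n)
  lem = solve-∀

-- Waring representations by digits.

-- Each `x ^ e` is at most the whole sum, hence below `b ^ e`, so every entry `x` is already a base
-- `b` digit.
vecDigits : ∀ e {s} (xs : Vec ℕ s) → Vec.sum (Vec.map (_^ e) xs) < b ^ e →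
            ∃ λ (ds : Expansion b) → length ds ≡ s × powerSum e ds ≡ Vec.sum (Vec.map (_^ e) xs)
vecDigits e []       _  = [] , refl , refl
vecDigits {b} e (x ∷ xs) lt =
  let ds , len , eq = vecDigits e xs (≤-<-trans (m≤n+m _ (x ^ e)) lt)
  in fromℕ< x<b ∷ ds , cong suc len , cong₂ _+_ (cong (_^ e) (Fin.toℕ-fromℕ< x<b)) eq
  where
  x<b : x < b
  x<b = ≰⇒> λ b≤x → <⇒≱ (≤-<-trans (m≤m+n (x ^ e) _) lt) (^-monoˡ-≤ e b≤x)

-- The number `pred (2 ^ e)` is too small to involve powers of anything but 0 and 1, that is, of
-- base 2 digits; each term gives at most 1, so at least `pred (2 ^ e)` terms are required.
2^e≤1+g : ∀ e {g} → IsWaring e g → 2 ^ e ≤ suc g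
2^e≤1+g e {g} (repr , _) = begin
  2 ^ e              ≡⟨ suc-pred (2 ^ e) ⟨
  suc (pred (2 ^ e)) ≤⟨ s≤s bound ⟩
  suc g              ∎
  where
  open ≤-Reasoning
  instance
    2^e≢0 : NonZero (2 ^ e)
    2^e≢0 = m^n≢0 2 e
  bound : pred (2 ^ e) ≤ g
  bound with repr (pred (2 ^ e))
  ... | xs , eq with vecDigits e xs (≤-reflexive (trans (cong suc eq) (suc-pred (2 ^ e))))
  ... | ds , len , eq′ = begin
    pred (2 ^ e)                  ≡⟨ trans eq′ eq ⟨
    powerSum {2} e ds             ≤⟨ powerSum-≤ e 1 ds (digits≤ ds) ⟩
    length ds * 1 ^ e             ≡⟨ cong₂ _*_ len (^-zeroˡ e) ⟩
    g * 1                         ≡⟨ *-identityʳ g ⟩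
    g                             ∎

-- Only the remainder modulo `c ^ e` is represented by Waring; it is small enough for `vecDigits` to
-- turn its `g` summands into digits.
greedy : ∀ c e g N .{{_ : NonZero c}} → IsWaring e g →
         let instance _ = m^n≢0 c e in
         ∃ λ (ds : Expansion (suc c)) → length ds ≡ N / c ^ e + g × powerSum e ds ≡ N
greedy c e g N (repr , _) with repr (_%_ N (c ^ e) {{m^n≢0 c e}})
... | xs , eq with vecDigits {suc c} e xs (begin-strict
        Vec.sum (Vec.map (_^ e) xs)  ≡⟨ eq ⟩
        N % c ^ e                    <⟨ m%n<n N (c ^ e) ⟩
        c ^ e                        ≤⟨ ^-monoˡ-≤ e (n≤1+n c) ⟩
        suc c ^ e                    ∎)
        where open ≤-Reasoning
              instance _ = m^n≢0 c e
... | ds , len , eq′ = replicate q d ++ ds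
    , trans (List.length-++ (replicate q d)) (cong₂ _+_ (List.length-replicate q) len)
    , (begin
        powerSum e (replicate q d ++ ds)  ≡⟨ powerSum-replicate q ⟩
        q * c ^ e + powerSum e ds         ≡⟨ cong (q * c ^ e +_) (trans eq′ eq) ⟩
        q * c ^ e + N % c ^ e             ≡⟨ +-comm (q * c ^ e) _ ⟩
        N % c ^ e + q * c ^ e             ≡⟨ m≡m%n+[m/n]*n N (c ^ e) ⟨
        N                                 ∎)
  where
  open ≡-Reasoning
  instance _ = m^n≢0 c e
  q = N / c ^ e
  d = Fin.fromℕ c
  powerSum-replicate : ∀ q → powerSum e (replicate q d ++ ds) ≡ q * c ^ e + powerSum e ds
  powerSum-replicate zero    = refl
  powerSum-replicate (suc q) = trans
    (cong₂ _+_ (cong (_^ e) (Fin.toℕ-fromℕ c)) (powerSum-replicate q))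
    (sym (+-assoc (c ^ e) (q * c ^ e) (powerSum e ds)))

-- Descent of `S` and periodic attractors.

-- For exponents of at least 2, `climb` lowers `j` until `u` lies between consecutive powers of the
-- base. Then `ds` has at most as many significant digits as `u`, and `*^<^` puts its power sum
-- below the lower of the two powers.
powerSum-below : ∀ a e g .{{_ : NonZero e}} → 2 ^ e ≤ suc g → ∀ {u} → (2+ a) ^ g ≤ u →
                 (ds : Expansion (2+ a)) → fromDigits ds ≤ u → powerSum e ds < u
powerSum-below a e g 2^e≤1+g {u} b^g≤u ds x≤u = go e 2^e≤1+g
  where
  open ≤-Reasoning
  base = 2+ a
  climb : ∀ e → 4 + e ≤ suc g → ∀ j → u < base ^ (g + j) → powerSum (2 + e) ds < u
  climb e 4+e≤1+g zero u< = contradiction b^g≤u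
    (<⇒≱ (subst (λ n → u < base ^ n) (+-identityʳ g) u<))
  climb e 4+e≤1+g (suc j) u< with u <? base ^ (g + j)
  ... | yes u<′ = climb e 4+e≤1+g j u<′
  -- Writing `g` as `3 + e + i` makes the digit bound `g + j + 1` equal to `4 + e + (i + j)`, the
  -- form that `*^<^` expects.
  ... | no  u≮ with i , refl ← m≤n⇒∃[o]m+o≡n (s≤s⁻¹ 4+e≤1+g) = begin-strict
    powerSum (2 + e) ds
      ≤⟨ powerSum-<^ (2 + e) (4 + e + (i + j)) ds (≤-<-trans x≤u (subst (λ n → u < base ^ n) (lem e i j) u<)) ⟩
    (4 + e + (i + j)) * suc a ^ (2 + e)
      <⟨ *^<^ (suc a) e (i + j) ⟩
    base ^ (3 + e + (i + j))
      ≡⟨ cong (base ^_) (+-assoc (3 + e) i j) ⟨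
    base ^ (3 + e + i + j)
      ≤⟨ ≮⇒≥ u≮ ⟩
    u ∎
    where
    lem : ∀ e i j → 3 + e + i + suc j ≡ 4 + e + (i + j)
    lem = solve-∀
  -- e = 1 needs its own argument: two digits can sum to b or more.
  go : ∀ e .{{_ : NonZero e}} → 2 ^ e ≤ suc g → powerSum e ds < u
  go 1 2≤1+g = powerSum₁-< ds (s≤s (s≤s z≤n))
    (≤-trans (≤-trans (≤-reflexive (sym (*-identityʳ base))) (^-monoʳ-≤ base (s≤s⁻¹ 2≤1+g))) b^g≤u) x≤u
  go (2+ e) 2^≤ with digits base u
  -- The digit count of `u` supplies a first power above `u` from which to descend.
  ... | us , refl = climb e (≤-trans (4+n≤2^[2+n] e) 2^≤) (length us)
    (<-≤-trans (fromDigits-< us) (^-monoʳ-≤ base (m≤n+m (length us) g)))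

S-below : ∀ a e g .{{_ : NonZero e}} → 2 ^ e ≤ suc g → ∀ {u x} →
          (2+ a) ^ g ≤ u → x ≤ u → S e (2+ a) x < u
S-below a e g 2^e≤1+g {u} {x} b^g≤u x≤u =
  let ds , eq = digits (2+ a) x
  in powerSum-below a e g 2^e≤1+g b^g≤u ds (subst (_≤ u) (sym eq) x≤u)

iterate-< : ∀ (f : ℕ → ℕ) {u} → (∀ {x} → x ≤ u → f x < u) → ∀ n {x} → x < u → iterate f x n < u
iterate-< f f< zero    x<u = x<u
iterate-< f f< (suc n) x<u = iterate-< f f< n (f< (<⇒≤ x<u))

-- Otherwise the first step drops strictly below `u` and no later step can climb back.
periodic⇒< : ∀ a e g .{{_ : NonZero e}} → 2 ^ e ≤ suc g → ∀ {u} n →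
             iterate (S e (2+ a)) u (suc n) ≡ u → u < (2+ a) ^ g
periodic⇒< a e g 2^e≤1+g {u} n per = ≰⇒> λ b^g≤u →
  let f< = λ {x} → S-below a e g 2^e≤1+g {u} {x} b^g≤u
  in <-irrefl per (iterate-< (S e (2+ a)) f< n (f< ≤-refl))

-- Minimality of the attracted number.

-- The orbits of `x` and `k` agree from the first step on, so only step 0 could reach `u` earlier,
-- and `x ≢ u` rules that out.
IsHeight-cong : ∀ b e .{{_ : NonTrivial b}} {u x k h} → S e b x ≡ S e b k → x ≢ u →
                IsHeight e b u k (suc h) → IsHeight e b u x (suc h)
IsHeight-cong b e {u} {x} {k} {h} Sx≡Sk x≢u (hit , least) =
  trans (same h) hit , first
  where
  same : ∀ n → iterate (S e b) x (suc n) ≡ iterate (S e b) k (suc n)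
  same n = cong (λ y → iterate (S e b) y n) Sx≡Sk
  first : ∀ n → iterate (S e b) x n ≡ u → suc h ≤ n
  first zero    eq = contradiction eq x≢u
  first (suc n) eq = least (suc n) (trans (sym (same n)) eq)

-- Heights and the attractor are left out on purpose: competitors are arbitrary digit strings, so
-- digits can be swapped or prepended freely.
Minimal : (e : ℕ) → Expansion b → Set
Minimal {b} e ds = ∀ (es : Expansion b) → powerSum e es ≡ powerSum e ds → fromDigits ds ≤ fromDigits es

-- A competitor other than `u` inherits the height of `k` through `IsHeight-cong`, so leastness of
-- `k` applies. The competitor `u` itself has height 0 and must be excluded by size.
σ-minimal : ∀ a e g h {u k} .{{_ : NonZero e}} .{{_ : NonZero u}} → 2 ^ e ≤ suc g →
            Isσ (suc h) e (2+ a) u k → (2+ a) ^ suc g ≤ k →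
            (ds : Expansion (2+ a)) → fromDigits ds ≡ k → Minimal e ds
σ-minimal a e g h {u} 2^e≤1+g ((0<k , height) , least) b^≤k ds refl es eq with fromDigits es ≟ u
... | no  x≢u = least (fromDigits es)
  (n≢0⇒n>0 (λ x≡0 → <⇒≢ 0<k (sym (powerSum≡0⇒fromDigits≡0 e ds (trans (sym eq) (powerSum-zero e es x≡0)))))
  , IsHeight-cong (2+ a) e Sx≡Sk x≢u height)
  where
  Sx≡Sk : S e (2+ a) (fromDigits es) ≡ S e (2+ a) (fromDigits ds)
  Sx≡Sk = trans (S-fromDigits e es) (trans eq (sym (S-fromDigits e ds)))
... | yes refl = contradiction (≤-trans b^≤k k≤ub) (<⇒≱ ub<)
  where
  base = 2+ a
  -- This string has value `u * base`: the zero goes to the least significant end and leaves the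
  -- power sum unchanged.
  0∷ = Fin.zero {suc a} ∷ es
  powerSum-0∷ : powerSum e 0∷ ≡ powerSum e es
  powerSum-0∷ = cong (_+ powerSum e es) (lem e)
    where
    lem : ∀ e .{{_ : NonZero e}} → 0 ^ e ≡ 0
    lem (suc _) = refl
  Su≡Sk : S e base u ≡ S e base (fromDigits ds)
  Su≡Sk = trans (S-fromDigits e es) (trans eq (sym (S-fromDigits e ds)))
  ub≢u : u * base ≢ u
  ub≢u eq = <-irrefl (sym eq) (m<m*n u base (s≤s (s≤s z≤n)))
  k≤ub : fromDigits ds ≤ u * base
  k≤ub = least (u * base) (>-nonZero⁻¹ (u * base) {{m*n≢0 u base}} ,
    IsHeight-cong base e
      (trans (trans (S-fromDigits e 0∷) powerSum-0∷) (trans (sym (S-fromDigits e es)) Su≡Sk))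
      ub≢u height)
  ub< : u * base < base ^ suc g
  ub< = begin-strict
    u * base         <⟨ *-monoˡ-< base (periodic⇒< a e g 2^e≤1+g h
                       (trans (cong (λ y → iterate (S e base) y h) Su≡Sk) (proj₁ height))) ⟩
    base ^ g * base  ≡⟨ *-comm (base ^ g) base ⟩
    base ^ suc g     ∎
    where open ≤-Reasoning

-- Monotonicity of the digits of a minimal string.

-- A competitor of the tail becomes one of the whole string once `d` is put in front.
Minimal-tail : ∀ e d (ds : Expansion b) → Minimal e (d ∷ ds) → Minimal e ds
Minimal-tail {suc _} e d ds min es eq =
  *-cancelʳ-≤ _ _ _ (+-cancelˡ-≤ (toℕ d) _ _ (min (d ∷ es) (cong (toℕ d ^ e +_) eq)))

-- Swapping the two lowest digits keeps the power sum and changes the value by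
-- `(c - d) * (base - 1)`, which minimality forbids to be negative.
Minimal-head : ∀ e c d (ds : Expansion (suc b)) → Minimal e (c ∷ d ∷ ds) → toℕ d ≤ toℕ c
-- In base 1 the factor `base - 1` vanishes, but the only digit is 0.
Minimal-head {zero}  e Fin.zero Fin.zero ds min = z≤n
Minimal-head {suc a} e c d ds min = *-cancelʳ-≤ (toℕ d) (toℕ c) (suc a)
  (+-cancelˡ-≤ (toℕ c + toℕ d + F * base * base) _ _ (begin
    toℕ c + toℕ d + F * base * base + toℕ d * suc a  ≡⟨ lem (toℕ c) (toℕ d) F a ⟩
    toℕ c + (toℕ d + F * base) * base                ≤⟨ min (d ∷ c ∷ ds) swap ⟩
    toℕ d + (toℕ c + F * base) * base                ≡⟨ lem′ (toℕ c) (toℕ d) F a ⟩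
    toℕ c + toℕ d + F * base * base + toℕ c * suc a  ∎))
  where
  open ≤-Reasoning
  base = 2+ a
  F = fromDigits ds
  lem : ∀ c d F a → c + d + F * (2+ a) * (2+ a) + d * suc a ≡ c + (d + F * (2+ a)) * (2+ a)
  lem = solve-∀
  lem′ : ∀ c d F a → d + (c + F * (2+ a)) * (2+ a) ≡ c + d + F * (2+ a) * (2+ a) + c * suc a
  lem′ = solve-∀
  exch : ∀ x y z → x + (y + z) ≡ y + (x + z)
  exch = solve-∀
  swap : powerSum e (d ∷ c ∷ ds) ≡ powerSum e (c ∷ d ∷ ds)
  swap = exch (toℕ d ^ e) (toℕ c ^ e) (powerSum e ds)

Minimal⇒Linked : ∀ e (ds : Expansion (suc b)) → Minimal e ds → Linked (λ c d → toℕ d ≤ toℕ c) ds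
Minimal⇒Linked e []           min = []
Minimal⇒Linked e (c ∷ [])     min = [-]
Minimal⇒Linked e (c ∷ d ∷ ds) min =
  Minimal-head e c d ds min ∷ Minimal⇒Linked e (d ∷ ds) (Minimal-tail e c (d ∷ ds) min)

-- The first digit at most `a` among the lowest `m` caps all higher digits; those before it form
-- `xs`. A string that ends too early falls into the second case with `ys` empty.
split-nonincreasing : ∀ a m (ds : Expansion (2+ a)) → Linked (λ c d → toℕ d ≤ toℕ c) ds →
        take m (map toℕ ds) ≡ replicate m (suc a) ⊎
        (∃ λ xs → ∃ λ ys → ds ≡ xs ++ ys × length xs < m × All (λ d → toℕ d ≤ a) ys)
split-nonincreasing a zero    ds       lnk = inj₁ refl
split-nonincreasing a (suc m) []       lnk = inj₂ ([] , [] , refl , z<s , [])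
split-nonincreasing a (suc m) (d ∷ ds) lnk with toℕ d ≤? a
... | yes d≤a = inj₂ ([] , d ∷ ds , refl , z<s ,
  All.map (λ y≤d → ≤-trans y≤d d≤a) (Linked⇒All (λ y≤x z≤y → ≤-trans z≤y y≤x) (≤-refl {toℕ d}) lnk))
... | no d≰a with split-nonincreasing a m ds (Linked.tail lnk)
...   | inj₁ eq = inj₁ (cong₂ _∷_ (≤-antisym (Fin.toℕ≤pred[n] d) (≰⇒> d≰a)) eq)
...   | inj₂ (xs , ys , eq , len , all) = inj₂ (d ∷ xs , ys , cong (d ∷_) eq , s≤s len , all)

-- Counting digits against the threshold.

-- A and B stand for (b − 1)ᵉ and (b − 2)ᵉ, as in threshold⇒≤.
threshold-length : ∀ g δ n {A B} .{{_ : NonZero A}} → B ≤ A →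
  (g + 1 + δ) * A + n * B ≤ n * A + δ * B → g + 1 + δ ≤ n
threshold-length g δ n {A} {B} B≤A ineq = ≮⇒≥ λ n<g+1+δ → impossible (m≤n⇒∃[o]m+o≡n n<g+1+δ)
  where
  open ≤-Reasoning
  impossible : ¬ (∃ λ j → suc n + j ≡ g + 1 + δ)
  -- With `suc n + j` in place of `g + 1 + δ`, the bounds `δ ≤ n + j` and `B ≤ A` cancel everything
  -- except `A ≤ 0`.
  impossible (j , eq) = <⇒≱ (>-nonZero⁻¹ A) (+-cancelˡ-≤ (n * A + n * B + j * A) A 0 (begin
    n * A + n * B + j * A + A  ≡⟨ lem n j A B ⟩
    (suc n + j) * A + n * B    ≡⟨ cong (λ z → z * A + n * B) eq ⟩
    (g + 1 + δ) * A + n * B    ≤⟨ ineq ⟩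
    n * A + δ * B              ≤⟨ +-monoʳ-≤ (n * A) (*-monoˡ-≤ B δ≤n+j) ⟩
    n * A + (n + j) * B        ≡⟨ lem′ n j A B ⟩
    n * A + n * B + j * B      ≤⟨ +-monoʳ-≤ (n * A + n * B) (*-monoʳ-≤ j B≤A) ⟩
    n * A + n * B + j * A      ≡⟨ +-identityʳ _ ⟨
    n * A + n * B + j * A + 0  ∎))
    where
    δ≤n+j : δ ≤ n + j
    δ≤n+j = s≤s⁻¹ (≤-trans (≤-trans (m≤n+m (suc δ) g) (≤-reflexive (sym (+-assoc g 1 δ))))
                           (≤-reflexive (sym eq)))
    lem : ∀ n j A B → n * A + n * B + j * A + A ≡ (suc n + j) * A + n * B
    lem = solve-∀
    lem′ : ∀ n j A B → n * A + (n + j) * B ≡ n * A + n * B + j * B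
    lem′ = solve-∀

-- With `n = p + t`, the hypothesis says `(g + 1) * A ≤ (n - δ) * (A - B)`. Since `p ≤ δ`, the
-- factor `n - δ` is at most `t`, and the conclusion is `(g + 1) * A ≤ t * (A - B)` rearranged.
threshold-slack : ∀ g δ p t {A B} → B ≤ A → p ≤ δ →
  (g + 1 + δ) * A + (p + t) * B ≤ (p + t) * A + δ * B →
  p * A + t * B + (g + 1) * A ≤ (p + t) * A
threshold-slack g δ p t {A} {B} B≤A p≤δ ineq with q , refl ← m≤n⇒∃[o]m+o≡n p≤δ =
  +-cancelʳ-≤ (q * A + p * B) _ _ (begin
    p * A + t * B + (g + 1) * A + (q * A + p * B)  ≡⟨ lem g p q t A B ⟩
    (g + 1 + (p + q)) * A + (p + t) * B            ≤⟨ ineq ⟩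
    (p + t) * A + (p + q) * B                      ≡⟨ cong ((p + t) * A +_) (lem′ p q B) ⟩
    (p + t) * A + (q * B + p * B)
      ≤⟨ +-monoʳ-≤ ((p + t) * A) (+-monoˡ-≤ (p * B) (*-monoʳ-≤ q B≤A)) ⟩
    (p + t) * A + (q * A + p * B)                  ∎)
  where
  open ≤-Reasoning
  lem : ∀ g p q t A B → p * A + t * B + (g + 1) * A + (q * A + p * B) ≡
                        (g + 1 + (p + q)) * A + (p + t) * B
  lem = solve-∀
  lem′ : ∀ p q B → (p + q) * B ≡ q * B + p * B
  lem′ = solve-∀

-- Dividing the slack inequality by `suc a ^ e` shows that the string from `greedy` has at most `n`
-- digits. Its value is then below `(2+ a) ^ n`, against minimality.
Minimal⇒no-slack : ∀ a e g n → IsWaring e g → (ds : Expansion (2+ a)) → (2+ a) ^ n ≤ fromDigits ds →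
  Minimal e ds → ¬ (powerSum e ds + (g + 1) * suc a ^ e ≤ suc n * suc a ^ e)
Minimal⇒no-slack a e g n waring ds b^n≤ds min slack with greedy (suc a) e g (powerSum e ds) waring
... | es , len , eq = <⇒≱ (begin-strict
    fromDigits es         <⟨ fromDigits-< es ⟩
    (2+ a) ^ length es    ≡⟨ cong ((2+ a) ^_) len ⟩
    (2+ a) ^ (q + g)      ≤⟨ ^-monoʳ-≤ (2+ a) q+g≤n ⟩
    (2+ a) ^ n            ≤⟨ b^n≤ds ⟩
    fromDigits ds         ∎) (min es eq)
  where
  open ≤-Reasoning
  A = suc a ^ e
  instance _ = m^n≢0 (suc a) e
  q = powerSum e ds / A
  q+g≤n : q + g ≤ n
  q+g≤n = s≤s⁻¹ (≤-trans (≤-reflexive (trans (sym (+-suc q g)) (cong (q +_) (sym (+-comm g 1)))))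
    (*-cancelʳ-≤ (q + (g + 1)) (suc n) A (begin
      (q + (g + 1)) * A             ≡⟨ *-distribʳ-+ A q (g + 1) ⟩
      q * A + (g + 1) * A           ≤⟨ +-monoˡ-≤ ((g + 1) * A) (m/n*n≤m (powerSum e ds) A) ⟩
      powerSum e ds + (g + 1) * A   ≤⟨ slack ⟩
      suc n * A                     ∎)))

theorem3p1 : ∀ (b e h u δ : ℕ)
    .{{_ : NonTrivial b}} .{{_ : NonZero e}} .{{_ : NonZero h}}
    .{{_ : NonZero u}} .{{_ : NonZero δ}}
    (g k : ℕ) → IsWaring e g → Isσ h e b u k →
    (ds : Expansion b) → IsExpansion b k ds →
    threshold b e g δ ℚ.≤ fromℕ (length ds) →
    take (suc δ) (map toℕ ds) ≡ replicate (suc δ) (b ∸ 1)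
theorem3p1 (2+ a) e (suc h) u δ g k waring isσ ds (value , last≢0) thr≤n =
  conclude (split-nonincreasing a (suc δ) ds (Minimal⇒Linked e ds min))
  where
  open ≤-Reasoning
  A = suc a ^ e
  B = a ^ e
  instance _ = m^n≢0 (suc a) e
  B≤A : B ≤ A
  B≤A = ^-monoˡ-≤ e (n≤1+n a)

  ineq : (g + 1 + δ) * A + length ds * B ≤ length ds * A + δ * B
  ineq = threshold⇒≤ a e g δ (length ds) thr≤n

  -- Positivity of `δ` provides the second unit here; `σ-minimal` needs it to have `k` at least
  -- `(2+ a) ^ suc g`.
  2+g≤n : 2+ g ≤ length ds
  2+g≤n = begin
    2+ g       ≡⟨ +-comm 2 g ⟩
    g + 2      ≤⟨ +-monoʳ-≤ g (s≤s (>-nonZero⁻¹ δ)) ⟩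
    g + suc δ  ≡⟨ +-assoc g 1 δ ⟨
    g + 1 + δ  ≤⟨ threshold-length g δ (length ds) B≤A ineq ⟩
    length ds  ∎

  -- One less than the number of digits: as the top digit is nonzero, `(2+ a) ^ n` bounds `k` from
  -- below.
  n : ℕ
  n = pred (length ds)
  length≡ : length ds ≡ suc n
  length≡ = sym (suc-pred (length ds) {{>-nonZero (<-≤-trans z<s 2+g≤n)}})
  b^n≤ds : (2+ a) ^ n ≤ fromDigits ds
  b^n≤ds = ^≤fromDigits ds last≢0 length≡

  min : Minimal e ds
  min = σ-minimal a e g h (2^e≤1+g e waring) isσ
    (≤-trans (^-monoʳ-≤ (2+ a) (s≤s⁻¹ (≤-trans 2+g≤n (≤-reflexive length≡))))
             (≤-trans b^n≤ds (≤-reflexive value)))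
    ds value

  conclude : take (suc δ) (map toℕ ds) ≡ replicate (suc δ) (suc a) ⊎
             (∃ λ xs → ∃ λ ys → ds ≡ xs ++ ys × length xs < suc δ × All (λ d → toℕ d ≤ a) ys) →
             take (suc δ) (map toℕ ds) ≡ replicate (suc δ) (suc a)
  conclude (inj₁ eq) = eq
  conclude (inj₂ (xs , ys , eq , p≤δ , small)) =
    contradiction slack (Minimal⇒no-slack a e g n waring ds b^n≤ds min)
    where
    p = length xs
    t = length ys
    p+t≡ : p + t ≡ length ds
    p+t≡ = trans (sym (List.length-++ xs)) (cong length (sym eq))
    slack : powerSum e ds + (g + 1) * A ≤ suc n * A
    slack = begin
      powerSum e ds + (g + 1) * A
        ≡⟨ cong (λ z → powerSum e z + (g + 1) * A) eq ⟩
      powerSum e (xs ++ ys) + (g + 1) * A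
        ≡⟨ cong (_+ (g + 1) * A) (powerSum-++ e xs ys) ⟩
      powerSum e xs + powerSum e ys + (g + 1) * A
        ≤⟨ +-monoˡ-≤ ((g + 1) * A)
             (+-mono-≤ (powerSum-≤ e (suc a) xs (digits≤ xs)) (powerSum-≤ e a ys small)) ⟩
      p * A + t * B + (g + 1) * A
        ≤⟨ threshold-slack g δ p t B≤A (s≤s⁻¹ p≤δ)
             (subst (λ n → (g + 1 + δ) * A + n * B ≤ n * A + δ * B) (sym p+t≡) ineq) ⟩
      (p + t) * A
        ≡⟨ cong (_* A) (trans p+t≡ length≡) ⟩
      suc n * A ∎
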